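{- Consider an instance $I$ of $R||C_{\max}$ with a value $\gamma>0$ such that $p_{i,j}\in[\gamma,3\gamma]\cup\{\infty\}$ for all machines $i$ and all jobs $j$. Then for this instance the configuration-LP has an integrality gap of at most $1+\frac{5}{6}$, i.e., $C^*(I)\le\left(1+\frac56\right)C_{\mathrm{conf}}(I)$, where $C^*(I)$ is the minimum makespan of $I$ and $C_{\mathrm{conf}}(I)$ is the smallest integer $T$ for which the configuration-LP of $I$ with target makespan $T$ is feasible.
   Context: $R||C_{\max}$: an instance consists of a finite nonempty set $J$ of jobs, a finite nonempty set $M$ of machines, and processing times $p_{i,j}\in\mathbb{N}^+\cup\{\infty\}$ for $i\in M$, $j\in J$, such that each job has finite processing time on at least one machine. A schedule assigns each job to one machine; the load of machine $i$ is the sum of $p_{i,j}$ over jobs $j$ assigned to $i$; the makespan is the maximum load. $C^*(I)$ is the minimum makespan over all assignments. Configuration-LP with target makespan $T$: for $i\in M$ let $\mathcal{C}_i(T)=\{C\subseteq J : \sum_{j\in C}p_{i,j}\le T\}$. The LP has variables $y_{i,C}\ge 0$ for $i\in M$, $C\in\mathcal{C}_i(T)$ and constraints $$\sum_{C\in\mathcal{C}_i(T)} y_{i,C}=1\ \text{ for all } i\in M,\qquad \sum_{i\in M}\ \sum_{C\in\mathcal{C}_i(T):\,C\ni j} y_{i,C}=1\ \text{ for all } j\in J.$$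
   Formalization: The value γ and the variables y of the configuration-LP are rational rather than real; since all processing times are integers or infinite, a real γ can be replaced by the least finite time, and LP feasibility over rationals and reals coincides. -}

module Defs where

open import Data.Bool.Base using (true; false)
open import Data.Empty using (⊥)
open import Data.Fin.Base using (Fin)
import Data.Fin.Properties as Fin
open import Data.Fin.Subset using (Subset; _∈_; inside; outside)
open import Data.Fin.Subset.Properties using (_∈?_)
open import Data.Integer.Base as ℤ using (+_)
open import Data.List.Base using (List; []; _∷_; _++_; map; filter; foldr; allFin)
open import Data.List.Membership.Propositional using () renaming (_∈_ to _∈ˡ_)
open import Data.List.Membership.Propositional.Properties
  using (∈-map⁺; ∈-map⁻; ∈-++⁺ˡ; ∈-++⁺ʳ)
open import Data.List.Relation.Unary.All using ([])
open import Data.List.Relation.Unary.AllPairs using ([]; _∷_)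
open import Data.List.Relation.Unary.Any using (here)
open import Data.List.Relation.Unary.Unique.Propositional using (Unique)
open import Data.List.Relation.Unary.Unique.Propositional.Properties
  using () renaming (map⁺ to unique-map⁺; ++⁺ to unique-++⁺)
open import Data.Nat.Base as ℕ using (ℕ; zero; suc; NonZero)
import Data.Nat.Properties as ℕ
open import Data.Product.Base using (∃; _×_; _,_)
open import Data.Rational.Base as ℚ using (ℚ; 0ℚ; 1ℚ)
open import Data.Unit.Base using (⊤)
open import Data.Vec.Base using ([]; _∷_)
open import Data.Vec.Properties using (∷-injectiveʳ)
import Relation.Binary.Construct.Add.Supremum.NonStrict as AddSupremum
open import Relation.Binary.Core using (Rel)
open import Relation.Binary.Definitions using () renaming (Decidable to Decidable₂)
open import Relation.Binary.PropositionalEquality.Core using (_≡_; _≢_; refl; sym; trans)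
open import Relation.Nullary.Construct.Add.Supremum using (_⁺; [_]; ⊤⁺)
open import Relation.Unary using (Pred; Decidable)
open import Level using (0ℓ)

ℕ∞ : Set
ℕ∞ = ℕ ⁺

pattern ∞ = ⊤⁺

open AddSupremum ℕ._≤_ public
  using () renaming (_≤⁺_ to _≤∞_; ≤⁺-dec to ≤∞-dec)

_≤∞?_ : Decidable₂ _≤∞_
_≤∞?_ = ≤∞-dec ℕ._≤?_

infixl 6 _+∞_ _⊔∞_

_+∞_ : ℕ∞ → ℕ∞ → ℕ∞
[ a ] +∞ [ b ] = [ a ℕ.+ b ]
[ _ ] +∞ ∞     = ∞
∞     +∞ _     = ∞

_⊔∞_ : ℕ∞ → ℕ∞ → ℕ∞
[ a ] ⊔∞ [ b ] = [ a ℕ.⊔ b ]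
[ _ ] ⊔∞ ∞     = ∞
∞     ⊔∞ _     = ∞

fromℕ : ℕ → ℚ
fromℕ k = + k ℚ./ 1

infix 4 _≤ᵠ_

_≤ᵠ_ : ℕ∞ → ℚ → Set
[ k ] ≤ᵠ q = fromℕ k ℚ.≤ q
∞     ≤ᵠ q = ⊥

infix 4 _∈[_,_]∪∞

-- For integral times, a real γ with all finite times in [γ, 3γ] exists iff a
-- rational one does (take the least finite time), so rational bounds suffice.
_∈[_,_]∪∞ : ℕ∞ → ℚ → ℚ → Set
[ k ] ∈[ a , b ]∪∞ = a ℚ.≤ fromℕ k × fromℕ k ℚ.≤ b
∞     ∈[ a , b ]∪∞ = ⊤

IsLeast : {A : Set} → Rel A 0ℓ → Pred A 0ℓ → A → Set
IsLeast _≤_ P x = P x × (∀ y → P y → x ≤ y)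

∑∞ : {A : Set} → List A → (A → ℕ∞) → ℕ∞
∑∞ xs f = foldr _+∞_ [ 0 ] (map f xs)

max∞ : {A : Set} → List A → (A → ℕ∞) → ℕ∞
max∞ xs f = foldr _⊔∞_ [ 0 ] (map f xs)

∑ᵠ : {A : Set} → List A → (A → ℚ) → ℚ
∑ᵠ xs f = foldr ℚ._+_ 0ℚ (map f xs)

allSubsets : ∀ n → List (Subset n)
allSubsets zero    = [] ∷ []
allSubsets (suc n) = map (inside ∷_) (allSubsets n) ++ map (outside ∷_) (allSubsets n)

∈-allSubsets : ∀ {n} (C : Subset n) → C ∈ˡ allSubsets n
∈-allSubsets []          = here refl
∈-allSubsets (true  ∷ C) = ∈-++⁺ˡ (∈-map⁺ (inside ∷_) (∈-allSubsets C))
∈-allSubsets {suc n} (false ∷ C) =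
  ∈-++⁺ʳ (map (inside ∷_) (allSubsets n)) (∈-map⁺ (outside ∷_) (∈-allSubsets C))

allSubsets-unique : ∀ n → Unique (allSubsets n)
allSubsets-unique zero    = [] ∷ []
allSubsets-unique (suc n) = unique-++⁺
  (unique-map⁺ ∷-injectiveʳ (allSubsets-unique n))
  (unique-map⁺ ∷-injectiveʳ (allSubsets-unique n))
  λ (p , q) → disjoint (∈-map⁻ (inside ∷_) p) (∈-map⁻ (outside ∷_) q)
  where
  disjoint : ∀ {C : Subset (suc n)} →
             ∃ (λ D → D ∈ˡ allSubsets n × C ≡ inside ∷ D) →
             ∃ (λ E → E ∈ˡ allSubsets n × C ≡ outside ∷ E) → ⊥
  disjoint (_ , _ , e) (_ , _ , e′) with trans (sym e) e′
  ... | ()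

record Instance : Set where
  field
    #machines #jobs : ℕ
    machines-nonempty : NonZero #machines
    jobs-nonempty     : NonZero #jobs
    p                 : Fin #machines → Fin #jobs → ℕ∞
    p-positive        : ∀ i j → [ 1 ] ≤∞ p i j
    schedulable       : ∀ j → ∃ λ i → p i j ≢ ∞

  Machine Job : Set
  Machine = Fin #machines
  Job     = Fin #jobs

module _ (I : Instance) where
  open Instance I

  Schedule : Set
  Schedule = Job → Machine

  load : Schedule → Machine → ℕ∞
  load σ i = ∑∞ (filter (λ j → σ j Fin.≟ i) (allFin #jobs)) (p i)

  makespan : Schedule → ℕ∞
  makespan σ = max∞ (allFin #machines) (load σ)

  IsC* : ℕ∞ → Set
  IsC* = IsLeast _≤∞_ (λ c → ∃ λ σ → makespan σ ≡ c)

  IsConfiguration : ℕ → Machine → Subset #jobs → Set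
  IsConfiguration T i C = ∑∞ (filter (_∈? C) (allFin #jobs)) (p i) ≤∞ [ T ]

  isConfiguration? : ∀ T i → Decidable (IsConfiguration T i)
  isConfiguration? T i C = _ ≤∞? _

  configurations : ℕ → Machine → List (Subset #jobs)
  configurations T i = filter (isConfiguration? T i) (allSubsets #jobs)

  -- The variables are the y i C with C a configuration for i; values of y at
  -- other subsets are unconstrained and unused.  All coefficients are
  -- rational, so feasibility over ℚ and over ℝ coincide.
  record ConfigLPSolution (T : ℕ) : Set where
    field
      y           : Machine → Subset #jobs → ℚ
      nonnegative : ∀ i C → IsConfiguration T i C → 0ℚ ℚ.≤ y i C
      machine-eq  : ∀ i → ∑ᵠ (configurations T i) (y i) ≡ 1ℚ
      job-eq      : ∀ j →
        ∑ᵠ (allFin #machines) (λ i → ∑ᵠ (filter (j ∈?_) (configurations T i)) (y i)) ≡ 1ℚ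

  -- Natural targets suffice: a negative target admits no configuration at all,
  -- so the equation of any machine already fails.
  IsCconf : ℕ → Set
  IsCconf = IsLeast ℕ._≤_ ConfigLPSolution

module Submission where

-- Scaling an LP solution by a common denominator D turns it into a list K i of D configurations
-- for every machine i; let L i be the list of all their jobs, so that every job occurs at least
-- D times altogether.  As in the rounding of Lenstra, Shmoys and Tardos, sort L i by decreasing
-- processing time and cut it into slots of D units.  A matching of jobs to slots gives a schedule
-- in which, for every i and t, the number of jobs of length > t on i is less than 1 + X / D, where
-- X is the number of units of L i of length > t.
-- If T ≥ 4γ, all jobs have length at most 3T/4, and summing over t bounds the loads by T + 3T/4.
-- If T < 4γ, a configuration has at most three jobs, and fewer than k of them exceed T / k; both
-- facts carry over to the schedule, so its loads are at most T + T/2 + T/3.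

open import Defs
open import Data.Fin.Base using (Fin)
import Data.Fin.Properties as Fin
open import Data.Fin.Subset using (Subset)
open import Data.Fin.Subset.Properties using (_∈?_)
open import Data.Integer.Base as ℤ using (+_; ∣_∣)
import Data.Integer.Properties as ℤ
open import Data.List.Base
  using (List; []; _∷_; _++_; map; filter; concatMap; allFin; length; upTo; downFrom; replicate)
open import Data.List.Properties
  using (length-map; length-upTo; length-downFrom; map-cong; map-∘; map-++)
open import Data.List.Membership.Propositional using (_∈_; _∉_; find; lose)
open import Data.List.Membership.Propositional.Properties
  using (∈-map⁺; ∈-map⁻; ∈-concatMap⁺; ∈-concatMap⁻; ∈-filter⁺; ∈-filter⁻; ∈-allFin; ∈-upTo⁺)
import Data.List.Membership.DecPropositional as DecMembership
open import Data.List.Relation.Binary.Permutation.Propositional using (_↭_)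
open import Data.List.Relation.Binary.Permutation.Propositional.Properties
  using (∈-resp-↭) renaming (map⁺ to ↭-map⁺)
open import Data.List.Relation.Binary.Subset.Propositional using (_⊆_)
open import Data.List.Relation.Unary.All as All using (All; []; _∷_)
open import Data.List.Relation.Unary.All.Properties using (¬Any⇒All¬; All¬⇒¬Any)
open import Data.List.Relation.Unary.AllPairs using (AllPairs; []; _∷_)
open import Data.List.Relation.Unary.Any using (here; there; any?)
open import Data.List.Relation.Unary.Sorted.TotalOrder.Properties using (Sorted⇒AllPairs)
open import Data.List.Relation.Unary.Unique.Propositional using (Unique)
open import Data.List.Relation.Unary.Unique.Propositional.Properties
  using (allFin⁺; filter⁺) renaming (map⁺ to unique-map⁺)
import Data.List.Sort as Sort
import Data.Nat.Coprimality as Coprime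
open import Data.Nat.Base
  using (ℕ; zero; suc; pred; _+_; _*_; _∸_; _⊓_; _⊔_; _/_; _%_; _≤_; _<_; z≤n; s≤s; s≤s⁻¹)
open import Data.Nat.DivMod using (m/n*n≤m; /-mono-≤; m*n/n≡m; m≡m%n+[m/n]*n; m%n<n)
open import Data.Nat.ListAction using (sum)
open import Data.Nat.ListAction.Properties using (sum-++; sum-↭)
open import Data.Nat.Properties
open import Data.Nat.Tactic.RingSolver using (solve-∀)
open import Data.Product.Base using (∃; _×_; _,_; proj₁; proj₂)
open import Data.Product.Properties using (≡-dec)
open import Data.Rational.Base as ℚ using (ℚ; 0ℚ; 1ℚ; mkℚ; ↥_)
import Data.Rational.Properties as ℚ
open import Data.Rational.Unnormalised.Base using (*≡*; *≤*)
import Data.Rational.Unnormalised.Properties as ℚᵘ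
open import Function.Base using (_∘_; id)
open import Level using (Level)
open import Relation.Binary.Bundles using (DecTotalOrder)
import Relation.Binary.Construct.Flip.EqAndOrd as Flip
import Relation.Binary.Construct.On as On
open import Relation.Binary.Construct.Add.Supremum.NonStrict _≤_ using ([_])
open import Relation.Binary.Definitions using (DecidableEquality)
open import Relation.Binary.PropositionalEquality
  using (_≡_; _≢_; refl; sym; trans; cong; cong₂; subst; module ≡-Reasoning)
open import Relation.Nullary using (Dec; yes; no; ¬_; contradiction; ¬?; _×-dec_)
open import Relation.Nullary.Construct.Add.Supremum using ([_])
open import Relation.Nullary.Decidable using (decidable-stable)
open import Relation.Unary using (Pred; Decidable)

-- Finite sums of natural numbers and indicator functions.

private
  variable
    ℓ : Level
    A B : Set
    xs ys : List A
    f g : A → ℕ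

𝟙 : {P : Set ℓ} → Dec P → ℕ
𝟙 (yes _) = 1
𝟙 (no _)  = 0

𝟙-true : {P : Set ℓ} (P? : Dec P) → P → 𝟙 P? ≡ 1
𝟙-true (yes _) _ = refl
𝟙-true (no ¬p) p = contradiction p ¬p

𝟙-false : {P : Set ℓ} (P? : Dec P) → ¬ P → 𝟙 P? ≡ 0
𝟙-false (yes p) ¬p = contradiction p ¬p
𝟙-false (no _)  _  = refl

𝟙-mono : ∀ {P Q : Set} (P? : Dec P) (Q? : Dec Q) → (P → Q) → 𝟙 P? ≤ 𝟙 Q?
𝟙-mono (yes p) Q? P⇒Q = ≤-reflexive (sym (𝟙-true Q? (P⇒Q p)))
𝟙-mono (no _)  Q? P⇒Q = z≤n

∑ : List A → (A → ℕ) → ℕ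
∑ xs f = sum (map f xs)

∑-cong : ∀ (xs : List A) → (∀ x → f x ≡ g x) → ∑ xs f ≡ ∑ xs g
∑-cong xs f≡g = cong sum (map-cong f≡g xs)

∑-mono : ∀ (xs : List A) → (∀ x → x ∈ xs → f x ≤ g x) → ∑ xs f ≤ ∑ xs g
∑-mono []       f≤g = z≤n
∑-mono (x ∷ xs) f≤g = +-mono-≤ (f≤g x (here refl)) (∑-mono xs (λ y y∈ → f≤g y (there y∈)))

∑-const : ∀ (xs : List A) c → ∑ xs (λ _ → c) ≡ length xs * c
∑-const []       c = refl
∑-const (x ∷ xs) c = cong (λ n → c + n) (∑-const xs c)

∑-+ : ∀ (xs : List A) → ∑ xs (λ x → f x + g x) ≡ ∑ xs f + ∑ xs g
∑-+                 []       = refl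
∑-+ {f = f} {g = g} (x ∷ xs) =
  trans (cong (λ n → f x + g x + n) (∑-+ xs)) (interchange (f x) (g x) (∑ xs f) (∑ xs g))
  where
  interchange : ∀ a b c d → a + b + (c + d) ≡ a + c + (b + d)
  interchange = solve-∀

∑-*ˡ : ∀ (xs : List A) c → ∑ xs (λ x → c * f x) ≡ c * ∑ xs f
∑-*ˡ         []       c = sym (*-zeroʳ c)
∑-*ˡ {f = f} (x ∷ xs) c = trans (cong (λ n → c * f x + n) (∑-*ˡ xs c)) (sym (*-distribˡ-+ c (f x) _))

∑-*ʳ : ∀ (xs : List A) c → ∑ xs (λ x → f x * c) ≡ ∑ xs f * c
∑-*ʳ         []       c = refl
∑-*ʳ {f = f} (x ∷ xs) c = trans (cong (λ n → f x * c + n) (∑-*ʳ xs c)) (sym (*-distribʳ-+ c (f x) _))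

∑-swap : ∀ (xs : List A) (ys : List B) (h : A → B → ℕ) →
         ∑ xs (λ x → ∑ ys (h x)) ≡ ∑ ys (λ y → ∑ xs (λ x → h x y))
∑-swap []       ys h = sym (trans (∑-const ys 0) (*-zeroʳ (length ys)))
∑-swap (x ∷ xs) ys h = trans (cong (λ n → ∑ ys (h x) + n) (∑-swap xs ys h)) (sym (∑-+ ys))

∑-map : ∀ (xs : List A) (h : A → B) {f : B → ℕ} → ∑ (map h xs) f ≡ ∑ xs (f ∘ h)
∑-map xs h = cong sum (sym (map-∘ xs))

∑-concatMap : ∀ (xs : List A) (h : A → List B) {f : B → ℕ} →
              ∑ (concatMap h xs) f ≡ ∑ xs (λ x → ∑ (h x) f)
∑-concatMap []       h     = refl
∑-concatMap (x ∷ xs) h {f} = begin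
  sum (map f (h x ++ concatMap h xs))       ≡⟨ cong sum (map-++ f (h x) _) ⟩
  sum (map f (h x) ++ map f (concatMap h xs)) ≡⟨ sum-++ (map f (h x)) _ ⟩
  ∑ (h x) f + ∑ (concatMap h xs) f                         ≡⟨ cong (λ n → ∑ (h x) f + n) (∑-concatMap xs h) ⟩
  ∑ (h x) f + ∑ xs (λ y → ∑ (h y) f)                       ∎
  where open ≡-Reasoning

∑-↭ : xs ↭ ys → ∑ xs f ≡ ∑ ys f
∑-↭ {f = f} xs↭ys = sum-↭ (↭-map⁺ f xs↭ys)

∑-replicate : ∀ n (x : A) → ∑ (replicate n x) f ≡ n * f x
∑-replicate         zero    x = refl
∑-replicate {f = f} (suc n) x = cong (λ n → f x + n) (∑-replicate n x)

∑-filter : ∀ {P : Pred A ℓ} (P? : Decidable P) xs → ∑ (filter P? xs) f ≡ ∑ xs (λ x → f x * 𝟙 (P? x))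
∑-filter         P? []       = refl
∑-filter {f = f} P? (x ∷ xs) with P? x
... | yes _ = cong₂ _+_ (sym (*-identityʳ (f x))) (∑-filter P? xs)
... | no  _ = trans (∑-filter P? xs) (cong (_+ ∑ xs (λ x → f x * 𝟙 (P? x))) (sym (*-zeroʳ (f x))))

∑-∈ : ∀ {x} → x ∈ xs → f x ≤ ∑ xs f
∑-∈ (here refl) = m≤m+n _ _
∑-∈ {xs = y ∷ _} {f = f} (there x∈xs) = ≤-trans (∑-∈ x∈xs) (m≤n+m _ (f y))

∑-𝟙≡length-filter : ∀ {P : Pred A ℓ} (P? : Decidable P) xs → ∑ xs (𝟙 ∘ P?) ≡ length (filter P? xs)
∑-𝟙≡length-filter P? []       = refl
∑-𝟙≡length-filter P? (x ∷ xs) with P? x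
... | yes _ = cong suc (∑-𝟙≡length-filter P? xs)
... | no  _ = ∑-𝟙≡length-filter P? xs

∑-𝟙-witness : ∀ {P : Pred A ℓ} (P? : Decidable P) xs → 1 ≤ ∑ xs (𝟙 ∘ P?) → ∃ λ x → x ∈ xs × P x
∑-𝟙-witness P? (x ∷ xs) 1≤∑ with P? x
... | yes Px = x , here refl , Px
... | no  _  with y , y∈xs , Py ← ∑-𝟙-witness P? xs 1≤∑ = y , there y∈xs , Py

-- Counting occurrences in lists.

module _ {A : Set} (_≟_ : DecidableEquality A) where

  open DecMembership _≟_ using (_∈?_)

  count-∉ : ∀ {x} xs → x ∉ xs → ∑ xs (λ y → 𝟙 (y ≟ x)) ≡ 0
  count-∉     []       x∉ = refl
  count-∉ {x} (y ∷ xs) x∉ = cong₂ _+_ (𝟙-false (y ≟ x) (x∉ ∘ here ∘ sym)) (count-∉ xs (x∉ ∘ there))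

  count-∈ : ∀ {x} {xs} → x ∈ xs → 1 ≤ ∑ xs (λ y → 𝟙 (y ≟ x))
  count-∈ {x} {xs} x∈ = subst (_≤ ∑ xs (λ y → 𝟙 (y ≟ x))) (𝟙-true (x ≟ x) refl) (∑-∈ x∈)

  count-unique : ∀ {xs} → Unique xs → ∀ x → ∑ xs (λ y → 𝟙 (y ≟ x)) ≤ 1
  count-unique []                     x = z≤n
  count-unique {y ∷ xs} (y∉xs ∷ xs!) x with y ≟ x
  ... | yes refl = ≤-reflexive (cong suc (count-∉ xs (All¬⇒¬Any y∉xs)))
  ... | no  _    = count-unique xs! x

  -- Double counting of the pairs of equal entries: each entry of `xs` has at least one partner in
  -- `ys`, and each entry of `ys` has at most one in `xs`, where nothing repeats.
  length-⊆ : ∀ {xs ys : List A} → Unique xs → xs ⊆ ys → length xs ≤ length ys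
  length-⊆ {xs} {ys} xs! xs⊆ys = begin
    length xs                             ≡⟨ *-identityʳ _ ⟨
    length xs * 1                         ≡⟨ ∑-const xs 1 ⟨
    ∑ xs (λ _ → 1)                        ≤⟨ ∑-mono xs (λ _ → count-∈ ∘ xs⊆ys) ⟩
    ∑ xs (λ x → ∑ ys (λ y → 𝟙 (y ≟ x)))   ≡⟨ ∑-swap xs ys _ ⟩
    ∑ ys (λ y → ∑ xs (λ x → 𝟙 (y ≟ x)))   ≤⟨ ∑-mono ys (λ y _ → ∑-mono xs (λ x _ → 𝟙-mono (y ≟ x) (x ≟ y) sym)) ⟩
    ∑ ys (λ y → ∑ xs (λ x → 𝟙 (x ≟ y)))   ≤⟨ ∑-mono ys (λ y _ → count-unique xs! y) ⟩
    ∑ ys (λ _ → 1)                        ≡⟨ ∑-const ys 1 ⟩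
    length ys * 1                         ≡⟨ *-identityʳ _ ⟩
    length ys                             ∎
    where open ≤-Reasoning

-- Matchings in bipartite multigraphs by augmenting paths.

-- E is a bipartite multigraph, given as its list of edges.  If the left degrees are at least
-- D = 1 + d and the right degrees at most D, then some matching covers the left side.
module Matching {A B : Set}
  (_≟ᴬ_ : DecidableEquality A) (_≟ᴮ_ : DecidableEquality B)
  (E : List (A × B)) (d : ℕ)
  (left-degree  : ∀ a → suc d ≤ ∑ E (λ e → 𝟙 (a ≟ᴬ proj₁ e)))
  (right-degree : ∀ b → ∑ E (λ e → 𝟙 (b ≟ᴮ proj₂ e)) ≤ suc d)
  where

  open DecMembership _≟ᴬ_ using () renaming (_∈?_ to _∈ᴬ?_)
  open DecMembership _≟ᴮ_ using () renaming (_∈?_ to _∈ᴮ?_)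

  -- Double counting of the edges leaving R.
  length-closed : ∀ {R S} → Unique R → (∀ e → e ∈ E → proj₁ e ∈ R → proj₂ e ∈ S) →
                  length R ≤ length S
  length-closed {R} {S} R! closed = *-cancelʳ-≤ _ _ (suc d) (begin
    length R * suc d                               ≡⟨ ∑-const R (suc d) ⟨
    ∑ R (λ _ → suc d)                              ≤⟨ ∑-mono R (λ a _ → left-degree a) ⟩
    ∑ R (λ a → ∑ E (λ e → 𝟙 (a ≟ᴬ proj₁ e)))       ≡⟨ ∑-swap R E _ ⟩
    ∑ E (λ e → ∑ R (λ a → 𝟙 (a ≟ᴬ proj₁ e)))       ≤⟨ ∑-mono E edge ⟩
    ∑ E (λ e → ∑ S (λ b → 𝟙 (b ≟ᴮ proj₂ e)))       ≡⟨ ∑-swap E S _ ⟩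
    ∑ S (λ b → ∑ E (λ e → 𝟙 (b ≟ᴮ proj₂ e)))       ≤⟨ ∑-mono S (λ b _ → right-degree b) ⟩
    ∑ S (λ _ → suc d)                              ≡⟨ ∑-const S (suc d) ⟩
    length S * suc d                               ∎)
    where
    open ≤-Reasoning
    edge : ∀ e → e ∈ E → ∑ R (λ a → 𝟙 (a ≟ᴬ proj₁ e)) ≤ ∑ S (λ b → 𝟙 (b ≟ᴮ proj₂ e))
    edge e e∈E with proj₁ e ∈ᴬ? R
    ... | yes e∈R = ≤-trans (count-unique _≟ᴬ_ R! (proj₁ e)) (count-∈ _≟ᴮ_ (closed e e∈E e∈R))
    ... | no  e∉R = ≤-trans (≤-reflexive (count-∉ _≟ᴬ_ R e∉R)) z≤n

  -- The map is total, so that it can be changed pointwise; its values outside `P` are arbitrary.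
  IsMatching : (A → Set) → (A → B) → Set
  IsMatching P m = (∀ a → P a → (a , m a) ∈ E) ×
                   (∀ a a′ → P a → P a′ → m a ≡ m a′ → a ≡ a′)

  _[_↦_] : (A → B) → A → B → A → B
  (m [ r ↦ s ]) a with a ≟ᴬ r
  ... | yes _ = s
  ... | no  _ = m a

  update-≢ : ∀ m {r s a} → a ≢ r → (m [ r ↦ s ]) a ≡ m a
  update-≢ m {r} {s} {a} a≢r with a ≟ᴬ r
  ... | yes a≡r = contradiction a≡r a≢r
  ... | no _    = refl

  -- Serves both the switching along an alternating path and its final edge. Only `r` receives a new
  -- partner, so it suffices that `s` is not held by any other member of `P`.
  update-matching : ∀ {P Q m r s} → IsMatching Q m → (r , s) ∈ E →
                    (∀ a → P a → a ≢ r → Q a) → (∀ a → P a → a ≢ r → m a ≢ s) →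
                    IsMatching P (m [ r ↦ s ])
  update-matching {P} {Q} {m} {r} {s} (edges , injective) rs∈E P⇒Q avoids = edges′ , injective′
    where
    edges′ : ∀ a → P a → (a , (m [ r ↦ s ]) a) ∈ E
    edges′ a Pa with a ≟ᴬ r
    ... | yes refl = rs∈E
    ... | no  a≢r  = edges a (P⇒Q a Pa a≢r)
    injective′ : ∀ a a′ → P a → P a′ → (m [ r ↦ s ]) a ≡ (m [ r ↦ s ]) a′ → a ≡ a′
    injective′ a a′ Pa Pa′ eq with a ≟ᴬ r | a′ ≟ᴬ r
    ... | yes refl | yes refl = refl
    ... | yes refl | no a′≢r  = contradiction (sym eq) (avoids a′ Pa′ a′≢r)
    ... | no a≢r   | yes refl = contradiction eq (avoids a Pa a≢r)
    ... | no a≢r   | no a′≢r  = injective a a′ (P⇒Q a Pa a≢r) (P⇒Q a′ Pa′ a′≢r) eq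

  module Augment {Q a₀} (a₀∉Q : a₀ ∉ Q) (m₀ : A → B) (m₀-matching : IsMatching (_∈ Q) m₀) where

    -- r is reached from a₀ by an alternating path inside R; m is m₀ switched along it.
    record Reached (R : List A) (r : A) : Set where
      field
        m         : A → B
        matching  : IsMatching (λ a → a ∈ a₀ ∷ Q × a ≢ r) m
        unchanged : ∀ a → a ∈ Q → a ∉ R → m a ≡ m₀ a
        image     : ∀ a → a ∈ a₀ ∷ Q → a ≢ r → ∃ λ q → q ∈ Q × m a ≡ m₀ q

    reached-start : Reached (a₀ ∷ []) a₀
    reached-start = record
      { m = m₀
      ; matching = (λ { a (a∈ , a≢a₀) → proj₁ m₀-matching a (in-Q a∈ a≢a₀) })
                 , (λ { a a′ (a∈ , a≢a₀) (a′∈ , a′≢a₀) →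
                        proj₂ m₀-matching a a′ (in-Q a∈ a≢a₀) (in-Q a′∈ a′≢a₀) })
      ; unchanged = λ _ _ _ → refl
      ; image = λ a a∈ a≢a₀ → a , in-Q a∈ a≢a₀ , refl
      }
      where
      in-Q : ∀ {a} → a ∈ a₀ ∷ Q → a ≢ a₀ → a ∈ Q
      in-Q (here a≡a₀) a≢a₀ = contradiction a≡a₀ a≢a₀
      in-Q (there a∈Q) _    = a∈Q

    reached-weaken : ∀ {R R′ r} → R ⊆ R′ → Reached R r → Reached R′ r
    reached-weaken R⊆R′ ρ = record
      { Reached ρ hiding (unchanged)
      ; unchanged = λ a a∈Q a∉R′ → Reached.unchanged ρ a a∈Q (a∉R′ ∘ R⊆R′) }

    -- The path is prolonged from `r` to `q`: `r` takes over the partner `m₀ q`, and `q` becomes the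
    -- one vertex left without a partner. By `unchanged`, `q` still holds `m₀ q` before the switch,
    -- so injectivity keeps every other vertex away from it.
    reached-step : ∀ {R R′ r q} → R ⊆ R′ → r ∈ R → q ∈ Q → q ∉ R → (r , m₀ q) ∈ E →
                   Reached R r → Reached R′ q
    reached-step {R} {R′} {r} {q} R⊆R′ r∈R q∈Q q∉R rs∈E ρ = record
      { m = m [ r ↦ m₀ q ]
      ; matching = update-matching matching rs∈E
          (λ { a (a∈ , _) a≢r → a∈ , a≢r })
          (λ { a (a∈ , a≢q) a≢r ma≡m₀q → a≢q (proj₂ matching a q (a∈ , a≢r) (there q∈Q , q≢r)
                 (trans ma≡m₀q (sym (unchanged q q∈Q q∉R)))) })
      ; unchanged = λ a a∈Q a∉R′ →
          trans (update-≢ m (λ { refl → a∉R′ (R⊆R′ r∈R) })) (unchanged a a∈Q (a∉R′ ∘ R⊆R′))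
      ; image = image′
      }
      where
      open Reached ρ
      q≢r : q ≢ r
      q≢r refl = q∉R r∈R
      image′ : ∀ a → a ∈ a₀ ∷ Q → a ≢ q → ∃ λ q′ → q′ ∈ Q × (m [ r ↦ m₀ q ]) a ≡ m₀ q′
      image′ a a∈ _ with a ≟ᴬ r
      ... | yes _  = q , q∈Q , refl
      ... | no a≢r = image a a∈ a≢r

    -- Search for an augmenting path from `a₀`; `rs` collects the matched left vertices reached so
    -- far. Each round either finishes or adds a new vertex of `Q` to `rs`, so the fuel only has to
    -- exceed the number of vertices of `Q` not yet reached.
    grow : ∀ fuel rs → length Q < fuel + length rs → Unique rs → rs ⊆ Q →
           (∀ r → r ∈ a₀ ∷ rs → Reached (a₀ ∷ rs) r) → ∃ (IsMatching (_∈ a₀ ∷ Q))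
    grow zero rs Q<rs rs! rs⊆Q ρ =
      contradiction (length-⊆ _≟ᴬ_ rs! rs⊆Q) (<⇒≱ Q<rs)
    grow (suc fuel) rs Q<fuel rs! rs⊆Q ρ
      with any? (λ e → (proj₁ e ∈ᴬ? (a₀ ∷ rs)) ×-dec ¬? (proj₂ e ∈ᴮ? map m₀ rs)) E
    -- If all edges at `a₀ ∷ rs` end in `map m₀ rs`, double counting contradicts the degree bounds,
    -- since the latter list is one entry shorter.
    ... | no none = contradiction
      (≤-trans (length-closed (¬Any⇒All¬ rs (a₀∉Q ∘ rs⊆Q) ∷ rs!) closed) (≤-reflexive (length-map m₀ rs)))
      1+n≰n
      where
      closed : ∀ e → e ∈ E → proj₁ e ∈ a₀ ∷ rs → proj₂ e ∈ map m₀ rs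
      closed e e∈E r∈ = decidable-stable (proj₂ e ∈ᴮ? map m₀ rs) (λ s∉ → none (lose e∈E (r∈ , s∉)))
    ... | yes some with (r , s) , rs∈E , r∈ , s∉ ← find some | any? (λ q → m₀ q ≟ᴮ s) Q
    -- By `image`, switching along the path uses only right vertices that `m₀` uses on `Q`; hence
    -- `s` is still free and can be given to `r`.
    ...   | no free = m [ r ↦ s ] , update-matching matching rs∈E (λ a a∈ a≢r → a∈ , a≢r) avoids
      where
      open Reached (ρ r r∈)
      avoids : ∀ a → a ∈ a₀ ∷ Q → a ≢ r → m a ≢ s
      avoids a a∈ a≢r ma≡s with q , q∈Q , ma≡m₀q ← image a a∈ a≢r =
        free (lose q∈Q (trans (sym ma≡m₀q) ma≡s))
    -- The partner `q` of `s` is new: `s` lies outside `map m₀ rs`, and `a₀` is not in `Q`. So the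
    -- search continues from `q` as well.
    ...   | yes taken with q , q∈Q , refl ← find taken =
      grow fuel (q ∷ rs) (subst (length Q <_) (sym (+-suc fuel (length rs))) Q<fuel)
        (¬Any⇒All¬ rs q∉rs ∷ rs!) (λ { (here refl) → q∈Q ; (there a∈rs) → rs⊆Q a∈rs }) ρ′
      where
      q∉rs : q ∉ rs
      q∉rs q∈rs = s∉ (∈-map⁺ m₀ q∈rs)
      q∉R : q ∉ a₀ ∷ rs
      q∉R (here refl)  = a₀∉Q q∈Q
      q∉R (there q∈rs) = q∉rs q∈rs
      R⊆R′ : a₀ ∷ rs ⊆ a₀ ∷ q ∷ rs
      R⊆R′ (here a≡a₀)  = here a≡a₀
      R⊆R′ (there a∈rs) = there (there a∈rs)
      ρ′ : ∀ r → r ∈ a₀ ∷ q ∷ rs → Reached (a₀ ∷ q ∷ rs) r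
      ρ′ a (here a≡a₀)          = reached-weaken R⊆R′ (ρ a (here a≡a₀))
      ρ′ a (there (here refl))  = reached-step R⊆R′ r∈ q∈Q q∉R rs∈E (ρ r r∈)
      ρ′ a (there (there a∈rs)) = reached-weaken R⊆R′ (ρ a (there a∈rs))

    augment : ∃ (IsMatching (_∈ a₀ ∷ Q))
    augment = grow (suc (length Q)) [] (m≤m+n _ 0) [] (λ ()) λ { r (here refl) → reached-start }

  matching : ∀ Q → Unique Q → ∃ (IsMatching (_∈ Q))
  -- Even the empty matching needs some function from `A` to `B`; positive left degrees provide an
  -- edge at every `a`, and its right end serves as the value.
  matching [] _ = (λ a → proj₂ (proj₁ (∑-𝟙-witness (λ e → a ≟ᴬ proj₁ e) E (≤-trans (s≤s z≤n) (left-degree a)))))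
                , (λ _ ()) , (λ _ _ ())
  matching (a ∷ Q) (a∉Q ∷ Q!) with m , m-matching ← matching Q Q! =
    Augment.augment (All¬⇒¬Any a∉Q) m m-matching

-- Rounding lists of units to a schedule through slots.

module Rounding {#m #n : ℕ} (key : Fin #m → Fin #n → ℕ) (L : Fin #m → List (Fin #n)) (d : ℕ)
  (covered : ∀ j → suc d ≤ ∑ (allFin #m) (λ i → ∑ (L i) (λ u → 𝟙 (j Fin.≟ u))))
  where

  private
    D = suc d

    descending : Fin #m → DecTotalOrder _ _ _
    descending i = On.decTotalOrder (Flip.decTotalOrder ≤-decTotalOrder) (key i)

  L↓ : Fin #m → List (Fin #n)
  L↓ i = Sort.sort (descending i) (L i)

  L↓-↭ : ∀ i → L↓ i ↭ L i
  L↓-↭ i = Sort.sort-↭ (descending i) (L i)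

  L↓-sorted : ∀ i → AllPairs (λ u v → key i v ≤ key i u) (L↓ i)
  L↓-sorted i = Sorted⇒AllPairs (DecTotalOrder.totalOrder (descending i)) (Sort.sort-↗ (descending i) (L i))

  -- The units of the list, counted from position q, are cut into slots of D consecutive units.
  slots : ℕ → List A → List (A × ℕ)
  slots q []       = []
  slots q (x ∷ xs) = (x , q / D) ∷ slots (suc q) xs

  ∑-slots : ∀ q (xs : List A) {f : A → ℕ} → ∑ (slots q xs) (f ∘ proj₁) ≡ ∑ xs f
  ∑-slots q []           = refl
  ∑-slots q (x ∷ xs) {f} = cong (λ n → f x + n) (∑-slots (suc q) xs)

  ∈-slots : ∀ q (xs : List A) {x s} → (x , s) ∈ slots q xs → x ∈ xs
  ∈-slots q (x ∷ xs) (here refl) = here refl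
  ∈-slots q (x ∷ xs) (there x∈)  = there (∈-slots (suc q) xs x∈)

  -- Slot `s` ends before position `suc s * D`, which bounds its units from position `q` on; this
  -- first bound carries the induction. At a unit of the slot, `s * D ≤ q` turns it into the bound
  -- `D`.
  slot-size : ∀ s q (xs : List A) → let c = ∑ (slots q xs) (λ e → 𝟙 (s ≟ proj₂ e)) in
              c ≤ suc s * D ∸ q × c ≤ D
  slot-size s q []       = z≤n , z≤n
  slot-size s q (x ∷ xs) with s ≟ q / D | slot-size s (suc q) xs
  ... | no  _    | c≤r , c≤D = ≤-trans c≤r (∸-monoʳ-≤ (suc s * D) (n≤1+n q)) , c≤D
  ... | yes refl | c≤r , _   = 1+c≤r , ≤-trans 1+c≤r r≤D
    where
    q<end : q < suc s * D
    q<end = begin-strict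
      q                         ≡⟨ m≡m%n+[m/n]*n q D ⟩
      q % D + s * D <⟨ +-monoˡ-< (s * D) (m%n<n q D) ⟩
      D + s * D                 ∎
      where open ≤-Reasoning
    1+c≤r : suc (∑ (slots (suc q) xs) (λ e → 𝟙 (s ≟ proj₂ e))) ≤ suc s * D ∸ q
    1+c≤r = ≤-trans (s≤s c≤r) (≤-reflexive (sym (+-∸-assoc 1 q<end)))
    r≤D : suc s * D ∸ q ≤ D
    r≤D = begin
      suc s * D ∸ q      ≤⟨ ∸-monoʳ-≤ (suc s * D) (m/n*n≤m q D) ⟩
      suc s * D ∸ s * D  ≡⟨ m+n∸n≡m D (s * D) ⟩
      D                  ∎
      where open ≤-Reasoning

  -- Keys descend, so all units listed before one with key above `t` also have key above `t`. Its
  -- slot starts no later than the unit itself, hence within the initial block of such units; `q`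
  -- counts the units already passed.
  slot-start : ∀ (k : A → ℕ) t q xs → AllPairs (λ u v → k v ≤ k u) xs →
               ∀ {x s} → (x , s) ∈ slots q xs → t < k x → s * D < q + ∑ xs (λ u → 𝟙 (t <? k u))
  slot-start k t q (y ∷ xs) (_ ∷ _) (here refl) t<kx = begin-strict
    q / D * D                                          ≤⟨ m/n*n≤m q D ⟩
    q                                                  <⟨ m<m+n q (s≤s z≤n) ⟩
    q + suc (∑ xs (λ u → 𝟙 (t <? k u)))                ≡⟨ cong (λ b → q + (b + _)) (𝟙-true (t <? k y) t<kx) ⟨
    q + (𝟙 (t <? k y) + ∑ xs (λ u → 𝟙 (t <? k u)))     ∎
    where open ≤-Reasoning
  slot-start k t q (y ∷ xs) (y≥ ∷ xs↘) {x} {s} (there x∈) t<kx = begin-strict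
    s * D                                              <⟨ slot-start k t (suc q) xs xs↘ x∈ t<kx ⟩
    suc q + ∑ xs (λ u → 𝟙 (t <? k u))                  ≡⟨ +-suc q _ ⟨
    q + suc (∑ xs (λ u → 𝟙 (t <? k u)))                ≡⟨ cong (λ b → q + (b + _)) (𝟙-true (t <? k y) t<ky) ⟨
    q + (𝟙 (t <? k y) + ∑ xs (λ u → 𝟙 (t <? k u)))     ∎
    where
    open ≤-Reasoning
    t<ky : t < k y
    t<ky = <-≤-trans t<kx (All.lookup y≥ (∈-slots (suc q) xs x∈))

  Slot : Set
  Slot = Fin #m × ℕ

  _≟ˢ_ : DecidableEquality Slot
  _≟ˢ_ = ≡-dec Fin._≟_ _≟_

  machine-edges : Fin #m → List (Fin #n × Slot)
  machine-edges i = map (λ (j , s) → j , i , s) (slots 0 (L↓ i))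

  edges : List (Fin #n × Slot)
  edges = concatMap machine-edges (allFin #m)

  left-degree : ∀ j → D ≤ ∑ edges (λ e → 𝟙 (j Fin.≟ proj₁ e))
  left-degree j = begin
    D                                                                       ≤⟨ covered j ⟩
    ∑ (allFin #m) (λ i → ∑ (L i) (λ u → 𝟙 (j Fin.≟ u)))                     ≡⟨ ∑-cong (allFin #m) machine ⟨
    ∑ (allFin #m) (λ i → ∑ (machine-edges i) (λ e → 𝟙 (j Fin.≟ proj₁ e)))   ≡⟨ ∑-concatMap (allFin #m) machine-edges ⟨
    ∑ edges (λ e → 𝟙 (j Fin.≟ proj₁ e))                                     ∎
    where
    open ≤-Reasoning
    machine : ∀ i → ∑ (machine-edges i) (λ e → 𝟙 (j Fin.≟ proj₁ e)) ≡ ∑ (L i) (λ u → 𝟙 (j Fin.≟ u))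
    machine i = trans (∑-map (slots 0 (L↓ i)) _) (trans (∑-slots 0 (L↓ i)) (∑-↭ (L↓-↭ i)))

  -- Only the edges of machine `i` can end in a slot of `i`, and there `slot-size` applies.
  right-degree : ∀ s → ∑ edges (λ e → 𝟙 (s ≟ˢ proj₂ e)) ≤ D
  right-degree (i , s) = begin
    ∑ edges (λ e → 𝟙 ((i , s) ≟ˢ proj₂ e))                                           ≡⟨ ∑-concatMap (allFin #m) machine-edges ⟩
    ∑ (allFin #m) (λ i′ → ∑ (machine-edges i′) (λ e → 𝟙 ((i , s) ≟ˢ proj₂ e)))       ≤⟨ ∑-mono (allFin #m) machine ⟩
    ∑ (allFin #m) (λ i′ → 𝟙 (i′ Fin.≟ i) * D)                                        ≡⟨ ∑-*ʳ (allFin #m) D ⟩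
    ∑ (allFin #m) (λ i′ → 𝟙 (i′ Fin.≟ i)) * D                                        ≤⟨ *-monoˡ-≤ D (count-unique Fin._≟_ (allFin⁺ #m) i) ⟩
    1 * D                                                                            ≡⟨ *-identityˡ D ⟩
    D                                                                                ∎
    where
    open ≤-Reasoning
    machine : ∀ i′ → i′ ∈ allFin #m →
              ∑ (machine-edges i′) (λ e → 𝟙 ((i , s) ≟ˢ proj₂ e)) ≤ 𝟙 (i′ Fin.≟ i) * D
    machine i′ _ with i′ Fin.≟ i
    ... | yes refl = begin
      ∑ (machine-edges i) (λ e → 𝟙 ((i , s) ≟ˢ proj₂ e))          ≡⟨ ∑-map (slots 0 (L↓ i)) _ ⟩
      ∑ (slots 0 (L↓ i)) (λ e → 𝟙 ((i , s) ≟ˢ (i , proj₂ e)))     ≤⟨ ∑-mono (slots 0 (L↓ i)) (λ e _ →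
                                                                       𝟙-mono ((i , s) ≟ˢ (i , proj₂ e)) (s ≟ proj₂ e) (cong proj₂)) ⟩
      ∑ (slots 0 (L↓ i)) (λ e → 𝟙 (s ≟ proj₂ e))                  ≤⟨ proj₂ (slot-size s 0 (L↓ i)) ⟩
      D                                                           ≡⟨ *-identityˡ D ⟨
      1 * D                                                       ∎
    ... | no i′≢i = begin
      ∑ (machine-edges i′) (λ e → 𝟙 ((i , s) ≟ˢ proj₂ e))         ≡⟨ ∑-map (slots 0 (L↓ i′)) _ ⟩
      ∑ (slots 0 (L↓ i′)) (λ e → 𝟙 ((i , s) ≟ˢ (i′ , proj₂ e)))   ≡⟨ ∑-cong (slots 0 (L↓ i′)) (λ e →
                                                                       𝟙-false ((i , s) ≟ˢ (i′ , proj₂ e)) (i′≢i ∘ sym ∘ cong proj₁)) ⟩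
      ∑ (slots 0 (L↓ i′)) (λ _ → 0)                               ≡⟨ ∑-const (slots 0 (L↓ i′)) 0 ⟩
      length (slots 0 (L↓ i′)) * 0                                ≡⟨ *-zeroʳ (length (slots 0 (L↓ i′))) ⟩
      0                                                           ∎

  abstract
    slot-matching : ∃ (Matching.IsMatching Fin._≟_ _≟ˢ_ edges d left-degree right-degree (_∈ allFin #n))
    slot-matching = Matching.matching Fin._≟_ _≟ˢ_ edges d left-degree right-degree (allFin #n) (allFin⁺ #n)

  slotOf : Fin #n → Slot
  slotOf = proj₁ slot-matching

  assign : Fin #n → Fin #m
  assign = proj₁ ∘ slotOf

  slotOf-injective : ∀ {j j′} → slotOf j ≡ slotOf j′ → j ≡ j′
  slotOf-injective {j} {j′} = proj₂ (proj₂ slot-matching) j j′ (∈-allFin j) (∈-allFin j′)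

  slotOf-edge : ∀ j → (j , proj₂ (slotOf j)) ∈ slots 0 (L↓ (assign j))
  slotOf-edge j with i , _ , e∈ ← find (∈-concatMap⁻ machine-edges {xs = allFin #m} (proj₁ (proj₂ slot-matching) j (∈-allFin j)))
    with (j′ , s) , e∈slots , eq ← ∈-map⁻ (λ (j , s) → j , i , s) e∈ =
      subst (λ e → (proj₁ e , proj₂ (proj₂ e)) ∈ slots 0 (L↓ (proj₁ (proj₂ e)))) (sym eq) e∈slots

  assign-supported : ∀ j → j ∈ L (assign j)
  assign-supported j = ∈-resp-↭ (L↓-↭ (assign j)) (∈-slots 0 _ (slotOf-edge j))

  -- The jobs on i with key above t occupy distinct slots, and these slots start among the
  -- units of L i with key above t.
  assign-count : ∀ i t {js} → Unique js → (∀ {j} → j ∈ js → assign j ≡ i) →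
                 D * ∑ js (λ j → 𝟙 (t <? key i j)) < D + ∑ (L i) (λ u → 𝟙 (t <? key i u))
  assign-count i t {js} js! on-i = begin-strict
    D * ∑ js (λ j → 𝟙 (t <? key i j))  ≡⟨ cong (D *_) (∑-𝟙≡length-filter (λ j → t <? key i j) js) ⟩
    D * length big                     ≡⟨ cong (D *_) (length-map slotOf big) ⟨
    D * length (map slotOf big)        ≤⟨ *-monoʳ-≤ D (length-⊆ _≟ˢ_ (unique-map⁺ slotOf-injective (filter⁺ _ js!)) used) ⟩
    D * length (map (i ,_) (upTo b))   ≡⟨ cong (D *_) (trans (length-map (i ,_) (upTo b)) (length-upTo b)) ⟩
    D * b                              ≡⟨ *-comm D b ⟩
    b * D                              ≤⟨ m/n*n≤m (d + X) D ⟩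
    d + X                              <⟨ n<1+n _ ⟩
    D + X                              ∎
    where
    open ≤-Reasoning
    X = ∑ (L i) (λ u → 𝟙 (t <? key i u))
    -- This is `X / D` rounded up, the number of slots `s` whose first position `s * D` is below
    -- `X`.
    b = (d + X) / D
    big = filter (λ j → t <? key i j) js
    start-units : ∀ j → assign j ≡ i → t < key i j → proj₂ (slotOf j) * D < X
    start-units j refl t<k = subst (proj₂ (slotOf j) * D <_) (∑-↭ (L↓-↭ (assign j)))
      (slot-start (key i) t 0 (L↓ i) (L↓-sorted i) (slotOf-edge j) t<k)
    start⇒<b : ∀ {s} → s * D < X → s < b
    start⇒<b {s} sD<X = begin
      suc s          ≡⟨ m*n/n≡m (suc s) D ⟨
      suc s * D / D  ≤⟨ /-mono-≤ {o = D} (begin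
        suc d + s * D  ≡⟨ +-suc d (s * D) ⟨
        d + suc (s * D) ≤⟨ +-monoʳ-≤ d sD<X ⟩
        d + X ∎) ≤-refl ⟩
      (d + X) / D    ∎
    used : map slotOf big ⊆ map (i ,_) (upTo b)
    used {s} s∈ with j , j∈big , refl ← ∈-map⁻ slotOf s∈
      with j∈js , t<k ← ∈-filter⁻ (λ j → t <? key i j) {xs = js} j∈big =
      subst (_∈ map (i ,_) (upTo b)) (cong (_, proj₂ (slotOf j)) (sym (on-i j∈js)))
        (∈-map⁺ (i ,_) (∈-upTo⁺ (start⇒<b (start-units j (on-i j∈js) t<k))))

-- Load bounds from the number of jobs above each threshold.

-- Layer-cake decomposition: a length is the number of thresholds below it. It turns counts above
-- thresholds into sums of lengths.
layers : ∀ P k → ∑ (downFrom P) (λ t → 𝟙 (t <? k)) ≡ P ⊓ k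
layers zero    k = refl
layers (suc P) k with P <? k
... | yes P<k = trans (cong suc (trans (layers P k) (m≤n⇒m⊓n≡m (<⇒≤ P<k)))) (sym (m≤n⇒m⊓n≡m P<k))
... | no  P≮k = let k≤P = ≮⇒≥ P≮k in
  trans (layers P k) (trans (m≥n⇒m⊓n≡n k≤P) (sym (m≥n⇒m⊓n≡n (m≤n⇒m≤1+n k≤P))))

-- Sum the counts over the thresholds below `P`; each contributes an excess of at most `D`. On the
-- left nothing is lost because no length exceeds `P`, and on the right truncation at `P` only
-- decreases lengths.
additive-bound : ∀ D P (k : A → ℕ) js us →
  (∀ t → D * ∑ js (λ j → 𝟙 (t <? k j)) ≤ D + ∑ us (λ u → 𝟙 (t <? k u))) →
  (∀ j → j ∈ js → k j ≤ P) → D * ∑ js k ≤ P * D + ∑ us k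
additive-bound D P k js us counts k≤P = begin
  D * ∑ js k                                                              ≤⟨ *-monoʳ-≤ D (∑-mono js layer-js) ⟩
  D * ∑ js (λ j → ∑ (downFrom P) (λ t → 𝟙 (t <? k j)))                    ≡⟨ cong (D *_) (∑-swap js (downFrom P) _) ⟩
  D * ∑ (downFrom P) (λ t → ∑ js (λ j → 𝟙 (t <? k j)))                    ≡⟨ ∑-*ˡ (downFrom P) D ⟨
  ∑ (downFrom P) (λ t → D * ∑ js (λ j → 𝟙 (t <? k j)))                    ≤⟨ ∑-mono (downFrom P) (λ t _ → counts t) ⟩
  ∑ (downFrom P) (λ t → D + ∑ us (λ u → 𝟙 (t <? k u)))                    ≡⟨ ∑-+ (downFrom P) ⟩
  ∑ (downFrom P) (λ _ → D) + ∑ (downFrom P) (λ t → ∑ us (λ u → 𝟙 (t <? k u)))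
    ≡⟨ cong₂ _+_ (trans (∑-const (downFrom P) D) (cong (_* D) (length-downFrom P))) (∑-swap (downFrom P) us _) ⟩
  P * D + ∑ us (λ u → ∑ (downFrom P) (λ t → 𝟙 (t <? k u)))                ≤⟨ +-monoʳ-≤ (P * D) (∑-mono us layer-us) ⟩
  P * D + ∑ us k                                                          ∎
  where
  open ≤-Reasoning
  layer-js : ∀ j → j ∈ js → k j ≤ ∑ (downFrom P) (λ t → 𝟙 (t <? k j))
  layer-js j j∈js = ≤-reflexive (sym (trans (layers P (k j)) (m≥n⇒m⊓n≡n (k≤P j j∈js))))
  layer-us : ∀ u → u ∈ us → ∑ (downFrom P) (λ t → 𝟙 (t <? k u)) ≤ k u
  layer-us u _ = ≤-trans (≤-reflexive (layers P (k u))) (m⊓n≤n P (k u))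

-- What a configuration of volume at most `T` satisfies: an integral length above `t` is at least
-- `suc t`, so `n` such jobs do not fit when `T < n * suc t`. The schedule inherits this property
-- although its loads may exceed `T`.
FewAbove : ℕ → (A → ℕ) → List A → Set
FewAbove T k xs = ∀ t n → T < n * suc t → ∑ xs (λ x → 𝟙 (t <? k x)) < n

FewAbove-tail : ∀ {T} (k : A → ℕ) x xs → FewAbove T k (x ∷ xs) → FewAbove T k xs
FewAbove-tail k x xs few t n T< = ≤-<-trans (m≤n+m _ _) (few t n T<)

-- For positive minimum, take the threshold one below it: all entries lie above, so their number
-- cannot be an `n` that `FewAbove` forbids.
FewAbove⇒length*min≤ : ∀ {T} x xs → All (x ≤_) xs → FewAbove T id (x ∷ xs) → suc (length xs) * x ≤ T
FewAbove⇒length*min≤ zero    xs x≤xs few = ≤-trans (≤-reflexive (*-zeroʳ (length xs))) z≤n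
FewAbove⇒length*min≤ (suc x) xs x≤xs few = ≮⇒≥ λ T< → <⇒≱ (few x _ T<) (begin
  suc (length xs)                            ≡⟨ *-identityʳ _ ⟨
  length (suc x ∷ xs) * 1                    ≡⟨ ∑-const (suc x ∷ xs) 1 ⟨
  ∑ (suc x ∷ xs) (λ _ → 1)                   ≤⟨ ∑-mono (suc x ∷ xs) (λ y y∈ →
                                                  ≤-reflexive (sym (𝟙-true (x <? y) (All.lookup (≤-refl ∷ x≤xs) y∈)))) ⟩
  ∑ (suc x ∷ xs) (λ y → 𝟙 (x <? y))          ∎)
  where open ≤-Reasoning

-- 11/6 = 1 + 1/2 + 1/3: there are at most three jobs, and the k-th largest is at most T / k.
harmonic-bound-sorted : ∀ T xs → AllPairs _≤_ xs → FewAbove T id xs →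
                        (∀ x → x ∈ xs → T < 4 * x) → 6 * sum xs ≤ 11 * T
harmonic-bound-sorted T [] _ _ _ = z≤n
harmonic-bound-sorted T (a ∷ []) (a≤ ∷ _) few _ = begin
  6 * (a + 0)   ≡⟨ eq a ⟩
  6 * (1 * a)   ≤⟨ *-monoʳ-≤ 6 (FewAbove⇒length*min≤ a [] a≤ few) ⟩
  6 * T         ≤⟨ *-monoˡ-≤ T (m≤m+n 6 5) ⟩
  11 * T        ∎
  where
  open ≤-Reasoning
  eq : ∀ a → 6 * (a + 0) ≡ 6 * (1 * a)
  eq = solve-∀
harmonic-bound-sorted T (a ∷ b ∷ []) (a≤ ∷ b≤ ∷ _) few _ = begin
  6 * (a + (b + 0))            ≡⟨ eq a b ⟩
  3 * (2 * a) + 6 * (1 * b)    ≤⟨ +-mono-≤ (*-monoʳ-≤ 3 (FewAbove⇒length*min≤ a (b ∷ []) a≤ few))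
                                           (*-monoʳ-≤ 6 (FewAbove⇒length*min≤ b [] b≤ few-b)) ⟩
  3 * T + 6 * T                ≡⟨ *-distribʳ-+ T 3 6 ⟨
  9 * T                        ≤⟨ *-monoˡ-≤ T (m≤m+n 9 2) ⟩
  11 * T                       ∎
  where
  open ≤-Reasoning
  few-b : FewAbove T id (b ∷ [])
  few-b = FewAbove-tail id a (b ∷ []) few
  eq : ∀ a b → 6 * (a + (b + 0)) ≡ 3 * (2 * a) + 6 * (1 * b)
  eq = solve-∀
harmonic-bound-sorted T (a ∷ b ∷ c ∷ []) (a≤ ∷ b≤ ∷ c≤ ∷ _) few _ = begin
  6 * (a + (b + (c + 0)))                      ≡⟨ eq₁ a b c ⟩
  -- In ascending order `a` is least of three, `b` least of two and `c` least of one, so `3 * a`,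
  -- `2 * b` and `c` are each at most `T`.
  2 * (3 * a) + (3 * (2 * b) + 6 * (1 * c))
    ≤⟨ +-mono-≤ (*-monoʳ-≤ 2 (FewAbove⇒length*min≤ a (b ∷ c ∷ []) a≤ few))
      (+-mono-≤ (*-monoʳ-≤ 3 (FewAbove⇒length*min≤ b (c ∷ []) b≤ few-bc))
                (*-monoʳ-≤ 6 (FewAbove⇒length*min≤ c [] c≤ few-c))) ⟩
  2 * T + (3 * T + 6 * T)                      ≡⟨ eq₂ T ⟩
  11 * T                                       ∎
  where
  open ≤-Reasoning
  few-bc : FewAbove T id (b ∷ c ∷ [])
  few-bc = FewAbove-tail id a (b ∷ c ∷ []) few
  few-c : FewAbove T id (c ∷ [])
  few-c = FewAbove-tail id b (c ∷ []) few-bc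
  eq₁ : ∀ a b c → 6 * (a + (b + (c + 0))) ≡ 2 * (3 * a) + (3 * (2 * b) + 6 * (1 * c))
  eq₁ = solve-∀
  eq₂ : ∀ T → 2 * T + (3 * T + 6 * T) ≡ 11 * T
  eq₂ = solve-∀
-- Four or more jobs would force `4 * a ≤ T`, against the lower bound on lengths.
harmonic-bound-sorted T (a ∷ b ∷ c ∷ d ∷ xs) (a≤ ∷ _) few large = contradiction
  (≤-trans (*-monoˡ-≤ a (m≤m+n 4 (length xs))) (FewAbove⇒length*min≤ a (b ∷ c ∷ d ∷ xs) a≤ few))
  (<⇒≱ (large a (here refl)))

harmonic-bound : ∀ T (k : A → ℕ) js → FewAbove T k js →
                 (∀ j → j ∈ js → T < 4 * k j) → 6 * ∑ js k ≤ 11 * T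
harmonic-bound T k js few large = subst (λ s → 6 * s ≤ 11 * T) (sum-↭ sorted-↭)
  (harmonic-bound-sorted T sorted (Sorted⇒AllPairs ≤-totalOrder (sort-↗ (map k js)))
    (λ t n T< → subst (_< n) (sym (trans (∑-↭ sorted-↭) (∑-map js k))) (few t n T<))
    large′)
  where
  open Sort ≤-decTotalOrder
  sorted = sort (map k js)
  sorted-↭ : sorted ↭ map k js
  sorted-↭ = sort-↭ (map k js)
  large′ : ∀ x → x ∈ sorted → T < 4 * x
  large′ x x∈ with j , j∈js , refl ← ∈-map⁻ k (∈-resp-↭ sorted-↭ x∈) = large j j∈js

-- Each part holds at most `n` items above `t`, so the `D` parts together hold at most `D * n`. The
-- strict inequality in the hypothesis on counts then leaves fewer than `suc n` jobs in `js`.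
few-above : ∀ {T D} (k : A → ℕ) js (parts : List B) (part : B → List A) → length parts ≡ D →
  (∀ t → D * ∑ js (λ j → 𝟙 (t <? k j)) < D + ∑ (concatMap part parts) (λ u → 𝟙 (t <? k u))) →
  (∀ C → C ∈ parts → ∑ (part C) k ≤ T) → FewAbove T k js
few-above {T = T} {D} k js parts part refl counts part≤T t (suc n) T< = *-cancelˡ-< D _ _ (begin-strict
  D * ∑ js (λ j → 𝟙 (t <? k j))                                <⟨ counts t ⟩
  D + ∑ (concatMap part parts) (λ u → 𝟙 (t <? k u))            ≡⟨ cong (λ n → D + n) (∑-concatMap parts part) ⟩
  D + ∑ parts (λ C → ∑ (part C) (λ u → 𝟙 (t <? k u)))          ≤⟨ +-monoʳ-≤ D (∑-mono parts few) ⟩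
  D + ∑ parts (λ _ → n)                                        ≡⟨ cong (λ n → D + n) (∑-const parts n) ⟩
  D + D * n                                                    ≡⟨ *-suc D n ⟨
  D * suc n                                                    ∎)
  where
  open ≤-Reasoning
  weight : ∀ x → 𝟙 (t <? x) * suc t ≤ x
  weight x with t <? x
  ... | yes t<x = ≤-trans (≤-reflexive (*-identityˡ (suc t))) t<x
  ... | no  _   = z≤n
  few : ∀ C → C ∈ parts → ∑ (part C) (λ u → 𝟙 (t <? k u)) ≤ n
  few C C∈ = s≤s⁻¹ (*-cancelʳ-< (suc t) _ (suc n) (begin-strict
    ∑ (part C) (λ u → 𝟙 (t <? k u)) * suc t        ≡⟨ ∑-*ʳ (part C) (suc t) ⟨
    ∑ (part C) (λ u → 𝟙 (t <? k u) * suc t)        ≤⟨ ∑-mono (part C) (λ u _ → weight (k u)) ⟩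
    ∑ (part C) k                                   ≤⟨ part≤T C C∈ ⟩
    T                                              <⟨ T< ⟩
    suc n * suc t                                  ∎))

-- Sums and maxima of possibly infinite values.

-- The value at `∞` is a placeholder; the load bounds concern jobs whose times are known to be
-- finite.
finite : ℕ∞ → ℕ
finite [ k ] = k
finite ∞     = 0

+∞-finite : ∀ a b {s} → a +∞ b ≡ [ s ] → a ≡ [ finite a ] × b ≡ [ finite b ] × s ≡ finite a + finite b
+∞-finite [ a ] [ b ] refl = refl , refl , refl

∑∞-finite : ∀ (xs : List A) f {s} → ∑∞ xs f ≡ [ s ] →
            (∀ x → x ∈ xs → f x ≡ [ finite (f x) ]) × s ≡ ∑ xs (finite ∘ f)
∑∞-finite []       f refl = (λ _ ()) , refl
∑∞-finite (x ∷ xs) f {s} eq with fx , rest , refl ← +∞-finite (f x) (∑∞ xs f) eq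
                    with fxs , eq′ ← ∑∞-finite xs f rest =
  (λ { _ (here refl) → fx ; y (there y∈) → fxs y y∈ }) , cong (λ n → finite (f x) + n) eq′

∑∞-≡ : ∀ (xs : List A) f → (∀ x → x ∈ xs → f x ≡ [ finite (f x) ]) → ∑∞ xs f ≡ [ ∑ xs (finite ∘ f) ]
∑∞-≡ []       f fin = refl
∑∞-≡ (x ∷ xs) f fin = cong₂ _+∞_ (fin x (here refl)) (∑∞-≡ xs f (λ y y∈ → fin y (there y∈)))

∑∞-≤ : ∀ (xs : List A) f {T} → ∑∞ xs f ≤∞ [ T ] →
       (∀ x → x ∈ xs → f x ≡ [ finite (f x) ]) × ∑ xs (finite ∘ f) ≤ T
∑∞-≤ xs f {T} ∑≤T with ∑∞ xs f in eq | ∑≤T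
... | [ s ] | [ s≤T ] with fin , refl ← ∑∞-finite xs f eq = fin , s≤T

max∞-bound : ∀ a b (xs : List A) (f : A → ℕ∞) →
             (∀ x → x ∈ xs → ∃ λ k → f x ≡ [ k ] × a * k ≤ b) →
             ∃ λ k → max∞ xs f ≡ [ k ] × a * k ≤ b
max∞-bound a b []       f bounded = 0 , refl , ≤-trans (≤-reflexive (*-zeroʳ a)) z≤n
max∞-bound a b (x ∷ xs) f bounded
  with k , fx≡k , ak≤b ← bounded x (here refl)
     | l , max≡l , al≤b ← max∞-bound a b xs f (λ y y∈ → bounded y (there y∈)) =
  k ⊔ l , cong₂ _⊔∞_ fx≡k max≡l , ≤-trans (≤-reflexive (*-distribˡ-⊔ a k l)) (⊔-lub ak≤b al≤b)

-- Natural numbers among the rationals and common denominators.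

-- The fraction `k / 1` in lowest terms, written out so that its numerator and denominator are
-- visible without the gcd computation behind `fromℕ k`.
normalised : ℕ → ℚ
normalised k = mkℚ (+ k) 0 (Coprime.sym (Coprime.1-coprimeTo k))

fromℕ-normalised : ∀ k → fromℕ k ≡ normalised k
fromℕ-normalised k = ℚ.normalize-coprime (Coprime.sym (Coprime.1-coprimeTo k))

fromℕ-numerator : ∀ k → ∣ ↥ fromℕ k ∣ ≡ k
fromℕ-numerator k = cong (∣_∣ ∘ ↥_) (fromℕ-normalised k)

fromℕ-numerator-≡ : ∀ q → ∃ (λ w → q ≡ fromℕ w) → q ≡ fromℕ ∣ ↥ q ∣
fromℕ-numerator-≡ _ (w , refl) = cong fromℕ {x = w} (sym (fromℕ-numerator w))

fromℕ-* : ∀ a b → fromℕ (a * b) ≡ fromℕ a ℚ.* fromℕ b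
fromℕ-* a b rewrite fromℕ-normalised a | fromℕ-normalised b = cong (ℚ._/ 1) (ℤ.pos-* a b)

fromℕ-+ : ∀ a b → fromℕ (a + b) ≡ fromℕ a ℚ.+ fromℕ b
fromℕ-+ a b rewrite fromℕ-normalised a | fromℕ-normalised b =
  cong (ℚ._/ 1) (cong₂ ℤ._+_ (sym (ℤ.*-identityʳ (+ a))) (sym (ℤ.*-identityʳ (+ b))))

fromℕ-injective : ∀ a b → fromℕ a ≡ fromℕ b → a ≡ b
fromℕ-injective a b eq = trans (sym (fromℕ-numerator a)) (trans (cong (∣_∣ ∘ ↥_) eq) (fromℕ-numerator b))

fromℕ-cancel-≤ : ∀ a b → fromℕ a ℚ.≤ fromℕ b → a ≤ b
fromℕ-cancel-≤ a b a≤b rewrite fromℕ-normalised a | fromℕ-normalised b with ℚ.*≤* le ← a≤b =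
  ℤ.drop‿+≤+ (ℤ.*-cancelʳ-≤-pos (+ a) (+ b) (+ 1) le)

fromℕ-cancel-< : ∀ a b → fromℕ a ℚ.< fromℕ b → a < b
fromℕ-cancel-< a b a<b rewrite fromℕ-normalised a | fromℕ-normalised b with ℚ.*<* lt ← a<b =
  ℤ.drop‿+<+ (ℤ.*-cancelʳ-<-nonNeg (+ 1) lt)

≤11/6 : ∀ k T → 6 * k ≤ 11 * T → fromℕ k ℚ.≤ (1ℚ ℚ.+ + 5 ℚ./ 6) ℚ.* fromℕ T
≤11/6 k T 6k≤11T rewrite fromℕ-normalised k | fromℕ-normalised T =
  ℚ.toℚᵘ-cancel-≤ (ℚᵘ.≤-respʳ-≃ (ℚᵘ.≃-sym (ℚ.toℚᵘ-homo-* (1ℚ ℚ.+ + 5 ℚ./ 6) (normalised T))) (*≤* le))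
  where
  le : + k ℤ.* + 6 ℤ.≤ + 11 ℤ.* + T ℤ.* + 1
  le = subst (_ ℤ.≤_) (trans (ℤ.pos-* 11 T) (sym (ℤ.*-identityʳ _)))
    (subst (ℤ._≤ + (11 * T)) (trans (cong +_ (*-comm 6 k)) (ℤ.pos-* k 6)) (ℤ.+≤+ 6k≤11T))

denominator-scales : ∀ q → 0ℚ ℚ.≤ q → fromℕ (ℚ.↧ₙ q) ℚ.* q ≡ fromℕ ∣ ↥ q ∣
denominator-scales q@(mkℚ (+ n) d-1 c) _ = begin
  fromℕ (suc d-1) ℚ.* q                          ≡⟨ cong (ℚ._* q) (fromℕ-normalised (suc d-1)) ⟩
  normalised (suc d-1) ℚ.* q                      ≡⟨ ℚ.toℚᵘ-injective (ℚᵘ.≃-trans (ℚ.toℚᵘ-homo-* (normalised (suc d-1)) q) (*≡* eq)) ⟩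
  normalised n                                    ≡⟨ fromℕ-normalised n ⟨
  fromℕ n                                        ∎
  where
  open ≡-Reasoning
  eq : (+ suc d-1 ℤ.* + n) ℤ.* + 1 ≡ + n ℤ.* + (1 * suc d-1)
  eq = trans (ℤ.*-identityʳ _) (trans (ℤ.*-comm (+ suc d-1) (+ n)) (cong (λ m → + n ℤ.* + m) (sym (*-identityˡ (suc d-1)))))
denominator-scales (mkℚ ℤ.-[1+ n ] d-1 c) (ℚ.*≤* ())

-- The product of all denominators works. It is given as a successor because the slots later need a
-- positive size.
common-denominator : ∀ qs → ∃ λ d → ∀ q → q ∈ qs → 0ℚ ℚ.≤ q → ∃ λ w → fromℕ (suc d) ℚ.* q ≡ fromℕ w
common-denominator []       = 0 , λ _ ()
common-denominator (q ∷ qs) with d , scales ← common-denominator qs =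
  pred (suc d * ℚ.↧ₙ q) , λ { _ (here refl) 0≤q → suc d * ∣ ↥ q ∣ , head 0≤q ; q′ (there q′∈) 0≤q′ → tail q′ q′∈ 0≤q′ }
  where
  open ≡-Reasoning
  head : 0ℚ ℚ.≤ q → fromℕ (suc d * ℚ.↧ₙ q) ℚ.* q ≡ fromℕ (suc d * ∣ ↥ q ∣)
  head 0≤q = begin
    fromℕ (suc d * ℚ.↧ₙ q) ℚ.* q                 ≡⟨ cong (ℚ._* q) (fromℕ-* (suc d) (ℚ.↧ₙ q)) ⟩
    fromℕ (suc d) ℚ.* fromℕ (ℚ.↧ₙ q) ℚ.* q       ≡⟨ ℚ.*-assoc (fromℕ (suc d)) _ q ⟩
    fromℕ (suc d) ℚ.* (fromℕ (ℚ.↧ₙ q) ℚ.* q)     ≡⟨ cong (fromℕ (suc d) ℚ.*_) (denominator-scales q 0≤q) ⟩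
    fromℕ (suc d) ℚ.* fromℕ ∣ ↥ q ∣              ≡⟨ fromℕ-* (suc d) ∣ ↥ q ∣ ⟨
    fromℕ (suc d * ∣ ↥ q ∣)                      ∎
  tail : ∀ q′ → q′ ∈ qs → 0ℚ ℚ.≤ q′ → ∃ λ w → fromℕ (suc d * ℚ.↧ₙ q) ℚ.* q′ ≡ fromℕ w
  tail q′ q′∈ 0≤q′ with w , eq ← scales q′ q′∈ 0≤q′ = ℚ.↧ₙ q * w , (begin
    fromℕ (suc d * ℚ.↧ₙ q) ℚ.* q′                ≡⟨ cong (λ m → fromℕ m ℚ.* q′) (*-comm (suc d) (ℚ.↧ₙ q)) ⟩
    fromℕ (ℚ.↧ₙ q * suc d) ℚ.* q′                ≡⟨ cong (ℚ._* q′) (fromℕ-* (ℚ.↧ₙ q) (suc d)) ⟩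
    fromℕ (ℚ.↧ₙ q) ℚ.* fromℕ (suc d) ℚ.* q′      ≡⟨ ℚ.*-assoc (fromℕ (ℚ.↧ₙ q)) _ q′ ⟩
    fromℕ (ℚ.↧ₙ q) ℚ.* (fromℕ (suc d) ℚ.* q′)    ≡⟨ cong (fromℕ (ℚ.↧ₙ q) ℚ.*_) eq ⟩
    fromℕ (ℚ.↧ₙ q) ℚ.* fromℕ w                   ≡⟨ fromℕ-* (ℚ.↧ₙ q) w ⟨
    fromℕ (ℚ.↧ₙ q * w)                           ∎)

∑ᵠ-scale : ∀ D (xs : List A) (f : A → ℚ) (w : A → ℕ) → (∀ x → x ∈ xs → fromℕ D ℚ.* f x ≡ fromℕ (w x)) →
           fromℕ D ℚ.* ∑ᵠ xs f ≡ fromℕ (∑ xs w)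
∑ᵠ-scale D []       f w scales = ℚ.*-zeroʳ (fromℕ D)
∑ᵠ-scale D (x ∷ xs) f w scales = begin
  fromℕ D ℚ.* (f x ℚ.+ ∑ᵠ xs f)                  ≡⟨ ℚ.*-distribˡ-+ (fromℕ D) (f x) _ ⟩
  fromℕ D ℚ.* f x ℚ.+ fromℕ D ℚ.* ∑ᵠ xs f        ≡⟨ cong₂ ℚ._+_ (scales x (here refl)) (∑ᵠ-scale D xs f w (λ y y∈ → scales y (there y∈))) ⟩
  fromℕ (w x) ℚ.+ fromℕ (∑ xs w)                 ≡⟨ fromℕ-+ (w x) (∑ xs w) ⟨
  fromℕ (w x + ∑ xs w)                           ∎
  where open ≡-Reasoning

∈-replicate : ∀ n {x y : A} → x ∈ replicate n y → x ≡ y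
∈-replicate (suc n) (here x≡y) = x≡y
∈-replicate (suc n) (there x∈) = ∈-replicate n x∈

≤∞⇒≤ᵠ : ∀ c k T → c ≤∞ [ k ] → 6 * k ≤ 11 * T → c ≤ᵠ (1ℚ ℚ.+ + 5 ℚ./ 6) ℚ.* fromℕ T
≤∞⇒≤ᵠ [ l ] k T [ l≤k ] 6k≤11T = ≤11/6 l T (≤-trans (*-monoʳ-≤ 6 l≤k) 6k≤11T)

4p≤3T : ∀ γ p T → fromℕ 4 ℚ.* γ ℚ.≤ fromℕ T → fromℕ p ℚ.≤ fromℕ 3 ℚ.* γ → 4 * p ≤ 3 * T
4p≤3T γ p T 4γ≤T p≤3γ = fromℕ-cancel-≤ (4 * p) (3 * T) (begin
  fromℕ (4 * p)                       ≡⟨ fromℕ-* 4 p ⟩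
  fromℕ 4 ℚ.* fromℕ p                 ≤⟨ ℚ.*-monoˡ-≤-nonNeg (fromℕ 4) p≤3γ ⟩
  fromℕ 4 ℚ.* (fromℕ 3 ℚ.* γ)         ≡⟨ ℚ.*-assoc (fromℕ 4) (fromℕ 3) γ ⟨
  fromℕ 4 ℚ.* fromℕ 3 ℚ.* γ           ≡⟨ cong (ℚ._* γ) (ℚ.*-comm (fromℕ 4) (fromℕ 3)) ⟩
  fromℕ 3 ℚ.* fromℕ 4 ℚ.* γ           ≡⟨ ℚ.*-assoc (fromℕ 3) (fromℕ 4) γ ⟩
  fromℕ 3 ℚ.* (fromℕ 4 ℚ.* γ)         ≤⟨ ℚ.*-monoˡ-≤-nonNeg (fromℕ 3) 4γ≤T ⟩
  fromℕ 3 ℚ.* fromℕ T                 ≡⟨ fromℕ-* 3 T ⟨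
  fromℕ (3 * T)                       ∎)
  where open ℚ.≤-Reasoning

T<4p : ∀ γ p T → ¬ (fromℕ 4 ℚ.* γ ℚ.≤ fromℕ T) → γ ℚ.≤ fromℕ p → T < 4 * p
T<4p γ p T 4γ≰T γ≤p = fromℕ-cancel-< T (4 * p) (begin-strict
  fromℕ T                             <⟨ ℚ.≰⇒> 4γ≰T ⟩
  fromℕ 4 ℚ.* γ                       ≤⟨ ℚ.*-monoˡ-≤-nonNeg (fromℕ 4) γ≤p ⟩
  fromℕ 4 ℚ.* fromℕ p                 ≡⟨ fromℕ-* 4 p ⟨
  fromℕ (4 * p)                       ∎)
  where open ℚ.≤-Reasoning

-- The scaled LP solution and the schedule obtained from it.

module Integral (I : Instance) {T : ℕ} (lp : ConfigLPSolution I T) where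
  open Instance I
  open ConfigLPSolution lp

  pᶠ : Machine → Job → ℕ
  pᶠ i j = finite (p i j)

  private
    confs : Machine → List (Subset #jobs)
    confs = configurations I T

  abstract
    denominator : ∃ λ d → ∀ q → q ∈ concatMap (λ i → map (y i) (confs i)) (allFin #machines) →
                  0ℚ ℚ.≤ q → ∃ λ w → fromℕ (suc d) ℚ.* q ≡ fromℕ w
    denominator = common-denominator (concatMap (λ i → map (y i) (confs i)) (allFin #machines))

  d D : ℕ
  d = proj₁ denominator
  D = suc d

  -- On configurations `D` times `y i C` is a natural number, and its numerator is that number.
  multiplicity : Machine → Subset #jobs → ℕ
  multiplicity i C = ∣ ↥ (fromℕ D ℚ.* y i C) ∣

  multiplicity-scales : ∀ i C → C ∈ confs i → fromℕ D ℚ.* y i C ≡ fromℕ (multiplicity i C)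
  multiplicity-scales i C C∈ = fromℕ-numerator-≡ (fromℕ D ℚ.* y i C)
    (proj₂ denominator (y i C)
      (∈-concatMap⁺ (λ i → map (y i) (confs i)) (lose (∈-allFin i) (∈-map⁺ (y i) C∈)))
      (nonnegative i C (proj₂ (∈-filter⁻ (isConfiguration? I T i) {xs = allSubsets #jobs} C∈))))

  -- The LP solution scaled by D: a list of D configurations for each machine.
  K : Machine → List (Subset #jobs)
  K i = concatMap (λ C → replicate (multiplicity i C) C) (confs i)

  ∑-K : ∀ i {f} → ∑ (K i) f ≡ ∑ (confs i) (λ C → multiplicity i C * f C)
  ∑-K i = trans (∑-concatMap (confs i) _) (∑-cong (confs i) (λ C → ∑-replicate (multiplicity i C) C))

  -- The machine equation multiplied by `D`.
  length-K : ∀ i → length (K i) ≡ D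
  length-K i = fromℕ-injective (length (K i)) D (begin
    fromℕ (length (K i))                                ≡⟨ cong fromℕ (trans (∑-const (K i) 1) (*-identityʳ (length (K i)))) ⟨
    fromℕ (∑ (K i) (λ _ → 1))                           ≡⟨ cong fromℕ (trans (∑-K i) (∑-cong (confs i) (λ C → *-identityʳ (multiplicity i C)))) ⟩
    fromℕ (∑ (confs i) (multiplicity i))                ≡⟨ ∑ᵠ-scale D (confs i) (y i) (multiplicity i) (multiplicity-scales i) ⟨
    fromℕ D ℚ.* ∑ᵠ (confs i) (y i)                      ≡⟨ cong (fromℕ D ℚ.*_) (machine-eq i) ⟩
    fromℕ D ℚ.* 1ℚ                                      ≡⟨ ℚ.*-identityʳ (fromℕ D) ⟩
    fromℕ D                                             ∎)
    where open ≡-Reasoning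

  elements : Subset #jobs → List Job
  elements C = filter (_∈? C) (allFin #jobs)

  K-configuration : ∀ i C → C ∈ K i → (∀ j → j ∈ elements C → p i j ≡ [ pᶠ i j ]) × ∑ (elements C) (pᶠ i) ≤ T
  K-configuration i C C∈ with C′ , C′∈ , C∈rep ← find (∈-concatMap⁻ (λ C → replicate (multiplicity i C) C) {xs = confs i} C∈)
    with refl ← ∈-replicate (multiplicity i C′) C∈rep =
    ∑∞-≤ (elements C) (p i) (proj₂ (∈-filter⁻ (isConfiguration? I T i) {xs = allSubsets #jobs} C′∈))

  L : Machine → List Job
  L i = concatMap elements (K i)

  L-finite : ∀ i j → j ∈ L i → p i j ≡ [ pᶠ i j ]
  L-finite i j j∈L with C , C∈ , j∈C ← find (∈-concatMap⁻ elements {xs = K i} j∈L) =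
    proj₁ (K-configuration i C C∈) j j∈C

  L-volume : ∀ i → ∑ (L i) (pᶠ i) ≤ D * T
  L-volume i = begin
    ∑ (L i) (pᶠ i)                               ≡⟨ ∑-concatMap (K i) elements ⟩
    ∑ (K i) (λ C → ∑ (elements C) (pᶠ i))        ≤⟨ ∑-mono (K i) (λ C C∈ → proj₂ (K-configuration i C C∈)) ⟩
    ∑ (K i) (λ _ → T)                            ≡⟨ ∑-const (K i) T ⟩
    length (K i) * T                             ≡⟨ cong (_* T) (length-K i) ⟩
    D * T                                        ∎
    where open ≤-Reasoning

  -- The job equation multiplied by `D`: the configurations containing `j` have total multiplicity
  -- `D`, and each copy contributes a unit of `j` to some `L i`.
  covered : ∀ j → D ≤ ∑ (allFin #machines) (λ i → ∑ (L i) (λ u → 𝟙 (j Fin.≟ u)))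
  covered j = begin
    D                                                                             ≡⟨ fromℕ-injective total D job-eq-scaled ⟨
    ∑ (allFin #machines) (λ i → ∑ (filter (j ∈?_) (confs i)) (multiplicity i))    ≤⟨ ∑-mono (allFin #machines) (λ i _ → machine i) ⟩
    ∑ (allFin #machines) (λ i → ∑ (L i) (λ u → 𝟙 (j Fin.≟ u)))                    ∎
    where
    open ≤-Reasoning
    weight : Machine → ℕ
    weight i = ∑ (filter (j ∈?_) (confs i)) (multiplicity i)
    total : ℕ
    total = ∑ (allFin #machines) weight
    weight-scales : ∀ i → i ∈ allFin #machines →
                    fromℕ D ℚ.* ∑ᵠ (filter (j ∈?_) (confs i)) (y i) ≡ fromℕ (weight i)
    weight-scales i _ = ∑ᵠ-scale D (filter (j ∈?_) (confs i)) (y i) (multiplicity i)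
      (λ C C∈ → multiplicity-scales i C (proj₁ (∈-filter⁻ (j ∈?_) {xs = confs i} C∈)))
    job-eq-scaled : fromℕ total ≡ fromℕ D
    job-eq-scaled = Eq.begin
      fromℕ total
        Eq.≡⟨ ∑ᵠ-scale D (allFin #machines) (λ i → ∑ᵠ (filter (j ∈?_) (confs i)) (y i)) weight weight-scales ⟨
      fromℕ D ℚ.* ∑ᵠ (allFin #machines) (λ i → ∑ᵠ (filter (j ∈?_) (confs i)) (y i))
        Eq.≡⟨ cong (fromℕ D ℚ.*_) (job-eq j) ⟩
      fromℕ D ℚ.* 1ℚ
        Eq.≡⟨ ℚ.*-identityʳ (fromℕ D) ⟩
      fromℕ D
        Eq.∎
      where module Eq = ≡-Reasoning
    occurs : ∀ C → 𝟙 (j ∈? C) ≤ ∑ (elements C) (λ u → 𝟙 (j Fin.≟ u))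
    occurs C with j ∈? C
    ... | no  _   = z≤n
    ... | yes j∈C = ≤-trans (count-∈ Fin._≟_ (∈-filter⁺ (_∈? C) (∈-allFin j) j∈C))
      (∑-mono (elements C) (λ u _ → 𝟙-mono (u Fin.≟ j) (j Fin.≟ u) sym))
    machine : ∀ i → ∑ (filter (j ∈?_) (confs i)) (multiplicity i) ≤ ∑ (L i) (λ u → 𝟙 (j Fin.≟ u))
    machine i = begin
      ∑ (filter (j ∈?_) (confs i)) (multiplicity i)                               ≡⟨ ∑-filter (j ∈?_) (confs i) ⟩
      ∑ (confs i) (λ C → multiplicity i C * 𝟙 (j ∈? C))                           ≡⟨ ∑-K i ⟨
      ∑ (K i) (λ C → 𝟙 (j ∈? C))                                                  ≤⟨ ∑-mono (K i) (λ C _ → occurs C) ⟩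
      ∑ (K i) (λ C → ∑ (elements C) (λ u → 𝟙 (j Fin.≟ u)))                        ≡⟨ ∑-concatMap (K i) elements ⟨
      ∑ (L i) (λ u → 𝟙 (j Fin.≟ u))                                               ∎

  open Rounding pᶠ L d covered public

  assigned : Machine → List Job
  assigned i = filter (λ j → assign j Fin.≟ i) (allFin #jobs)

  assigned-∈L : ∀ i j → j ∈ assigned i → j ∈ L i
  assigned-∈L i j j∈ = subst (λ i → j ∈ L i)
    (proj₂ (∈-filter⁻ (λ j → assign j Fin.≟ i) {xs = allFin #jobs} j∈)) (assign-supported j)

  -- Every job is placed on a machine that has it in one of its configurations, and a configuration
  -- contains only jobs of finite time.
  load-assign : ∀ i → load I assign i ≡ [ ∑ (assigned i) (pᶠ i) ]
  load-assign i = ∑∞-≡ (assigned i) (p i) (λ j j∈ → L-finite i j (assigned-∈L i j j∈))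

  assigned-count : ∀ i t → D * ∑ (assigned i) (λ j → 𝟙 (t <? pᶠ i j)) < D + ∑ (L i) (λ u → 𝟙 (t <? pᶠ i u))
  assigned-count i t = assign-count i t (filter⁺ _ (allFin⁺ #jobs))
    (λ j∈ → proj₂ (∈-filter⁻ (λ j → assign j Fin.≟ i) {xs = allFin #jobs} j∈))

  -- The volume of `L i` gives `T` on average and the additive error is at most `3T/4`, in total
  -- `21T/12`, which is below `22T/12 = 11T/6`. The chain is multiplied by `12 * D` to stay in the
  -- natural numbers.
  load-small-jobs : (∀ i j → p i j ≡ [ pᶠ i j ] → 4 * pᶠ i j ≤ 3 * T) →
                    ∀ i → 6 * ∑ (assigned i) (pᶠ i) ≤ 11 * T
  load-small-jobs small i = *-cancelˡ-≤ (2 * D) (begin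
    2 * D * (6 * x)              ≡⟨ eq₁ D x ⟩
    12 * (D * x)                 ≤⟨ *-monoʳ-≤ 12 (additive-bound D P (pᶠ i) (assigned i) (L i) (<⇒≤ ∘ assigned-count i) ≤P) ⟩
    12 * (P * D + ∑ (L i) (pᶠ i)) ≤⟨ *-monoʳ-≤ 12 (+-monoʳ-≤ (P * D) (L-volume i)) ⟩
    12 * (P * D + D * T)         ≡⟨ eq₂ D P T ⟩
    3 * D * (P * 4) + 12 * D * T ≤⟨ +-monoˡ-≤ (12 * D * T) (*-monoʳ-≤ (3 * D) (m/n*n≤m (3 * T) 4)) ⟩
    -- The slack between `21T/12` and `22T/12`.
    3 * D * (3 * T) + 12 * D * T ≤⟨ m≤m+n _ (D * T) ⟩
    3 * D * (3 * T) + 12 * D * T + D * T ≡⟨ eq₃ D T ⟩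
    2 * D * (11 * T)             ∎)
    where
    open ≤-Reasoning
    x = ∑ (assigned i) (pᶠ i)
    -- Rounding down is harmless, because the lengths are integers.
    P = 3 * T / 4
    ≤P : ∀ j → j ∈ assigned i → pᶠ i j ≤ P
    ≤P j j∈ = begin
      pᶠ i j          ≡⟨ m*n/n≡m (pᶠ i j) 4 ⟨
      pᶠ i j * 4 / 4  ≤⟨ /-mono-≤ {o = 4} (≤-trans (≤-reflexive (*-comm (pᶠ i j) 4)) (small i j (L-finite i j (assigned-∈L i j j∈)))) ≤-refl ⟩
      P               ∎
    eq₁ : ∀ D x → 2 * D * (6 * x) ≡ 12 * (D * x)
    eq₁ = solve-∀
    eq₂ : ∀ D P T → 12 * (P * D + D * T) ≡ 3 * D * (P * 4) + 12 * D * T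
    eq₂ = solve-∀
    eq₃ : ∀ D T → 3 * D * (3 * T) + 12 * D * T + D * T ≡ 2 * D * (11 * T)
    eq₃ = solve-∀

  -- The configurations in `K i` have volume at most `T`, so `few-above` transfers their `FewAbove`
  -- property to the jobs assigned to `i`.
  load-large-jobs : (∀ i j → p i j ≡ [ pᶠ i j ] → T < 4 * pᶠ i j) →
                    ∀ i → 6 * ∑ (assigned i) (pᶠ i) ≤ 11 * T
  load-large-jobs large i = harmonic-bound T (pᶠ i) (assigned i)
    (few-above (pᶠ i) (assigned i) (K i) elements (length-K i) (assigned-count i)
      (λ C C∈ → proj₂ (K-configuration i C C∈)))
    (λ j j∈ → large i j (L-finite i j (assigned-∈L i j j∈)))

  C*-bound : (∀ i → 6 * ∑ (assigned i) (pᶠ i) ≤ 11 * T) →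
             ∀ c → IsC* I c → c ≤ᵠ (1ℚ ℚ.+ + 5 ℚ./ 6) ℚ.* fromℕ T
  C*-bound load-bound c (_ , c-least) =
    let k , makespan≡k , 6k≤11T = max∞-bound 6 (11 * T) (allFin #machines) (load I assign)
          (λ i _ → ∑ (assigned i) (pᶠ i) , load-assign i , load-bound i)
    in ≤∞⇒≤ᵠ c k T (subst (c ≤∞_) makespan≡k (c-least (makespan I assign) (assign , refl))) 6k≤11T

theorem8 : (I : Instance) (γ : ℚ) → 0ℚ ℚ.< γ →
    (∀ i j → Instance.p I i j ∈[ γ , (+ 3 ℚ./ 1) ℚ.* γ ]∪∞) →
    ∀ (c : ℕ∞) (T : ℕ) → IsC* I c → IsCconf I T →
    c ≤ᵠ (1ℚ ℚ.+ + 5 ℚ./ 6) ℚ.* fromℕ T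
theorem8 I γ _ bounds c T c-least (lp , _) = C*-bound (load-bound (fromℕ 4 ℚ.* γ ℚ.≤? fromℕ T)) c c-least
  where
  open Instance I
  open Integral I lp
  finite-bounds : ∀ i j → p i j ≡ [ pᶠ i j ] → γ ℚ.≤ fromℕ (pᶠ i j) × fromℕ (pᶠ i j) ℚ.≤ fromℕ 3 ℚ.* γ
  finite-bounds i j p≡ = subst (_∈[ γ , fromℕ 3 ℚ.* γ ]∪∞) p≡ (bounds i j)
  load-bound : Dec (fromℕ 4 ℚ.* γ ℚ.≤ fromℕ T) → ∀ i → 6 * ∑ (assigned i) (pᶠ i) ≤ 11 * T
  load-bound (yes 4γ≤T) = load-small-jobs λ i j p≡ → 4p≤3T γ (pᶠ i j) T 4γ≤T (proj₂ (finite-bounds i j p≡))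
  load-bound (no  4γ≰T) = load-large-jobs λ i j p≡ → T<4p γ (pᶠ i j) T 4γ≰T (proj₁ (finite-bounds i j p≡))
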